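{- Let $A$ be an $m\times m$ coloring matrix all of whose row sums equal $r$. Then for every color $1\le i\le m$ and every $n\ge1$, $t_A^{(i)}(n)=r^{n-1}C_{n-1}$, and hence $t_A(n)=m\,r^{n-1}C_{n-1}$. In particular, all colors of $A$ are pairwise interchangeable, and any two $m\times m$ coloring matrices whose row sums all equal $r$ are strictly tree coloring equivalent.
   Context: A plane tree is an unlabeled rooted tree in which the children of every vertex are linearly ordered. A coloring matrix is an $m\times m$ matrix $A=(a_{ij})$ with entries in $\{0,1\}$. An $A$-coloring of a plane tree assigns to each vertex a color in $\{1,\dots,m\}$ such that whenever a vertex of color $j$ is a child of a vertex of color $i$, $a_{ij}=1$. Let $t_A(n)$ be the number of pairs (plane tree with $n$ vertices, $A$-coloring of it) and $t_A^{(i)}(n)$ the number of those with root color $i$. $C_k=\frac{1}{k+1}\binom{2k}{k}$ is the $k$-th Catalan number. Colors $i,j$ are interchangeable for $A$ if $t_A^{(i)}(n)=t_A^{(j)}(n)$ for all $n\ge1$. Two coloring matrices $A,B$ of the same size are strictly tree coloring equivalent if $t_A^{(i)}(n)=t_B^{(i)}(n)$ for all $n\ge1$ and all $i$. -}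

module Defs where

import Algebra.Properties.CommutativeMonoid.Sum
open import Data.Fin.Base using (Fin; toℕ)
open import Data.Fin.Patterns using (1F)
import Data.Fin.Properties as Fin
open import Data.List.Base using (List; []; _∷_; map; filter; length; concatMap; cartesianProductWith; allFin; upTo)
open import Data.List.Membership.Propositional using (_∈_; lose; find)
open import Data.List.Membership.Propositional.Properties using (∈-map⁺; ∈-map⁻; ∈-filter⁺; ∈-filter⁻; ∈-concatMap⁺; ∈-concatMap⁻; ∈-cartesianProductWith⁺; ∈-cartesianProductWith⁻; ∈-upTo⁺; ∈-upTo⁻; ∈-allFin)
open import Data.List.Relation.Unary.All as All using (All; []; _∷_)
import Data.List.Relation.Unary.All.Properties as All
open import Data.List.Relation.Unary.AllPairs as AllPairs using ([]; _∷_)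
import Data.List.Relation.Unary.AllPairs.Properties as AllPairs
open import Data.List.Relation.Unary.Any using (here)
open import Data.List.Relation.Unary.Unique.Propositional using (Unique)
import Data.List.Relation.Unary.Unique.Propositional.Properties as Unique
open import Data.Nat.Base using (ℕ; zero; suc; _+_; _*_; _∸_; _≤_; _≥_; z≤n; s≤s)
open import Data.Nat.Combinatorics using (_C_; nC1≡n; nCk+nC[k+1]≡[n+1]C[k+1])
open import Data.Nat.Combinatorics.Specification using (k>n⇒nCk≡0)
open import Data.Nat.DivMod using (_/_; m*[n/m]≡n)
open import Data.Nat.Divisibility using (divides)
open import Data.Nat.Properties using (+-0-commutativeMonoid; +-comm; +-cancelʳ-≡; +-identityʳ; *-comm; *-zeroʳ; *-identityʳ; *-distribˡ-+; *-distribˡ-∸; m+n∸n≡m; m+n∸m≡n; m+[n∸m]≡n; m≤m+n; m≤n+m; ≤-trans; ≤-refl; ≤-pred)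
open import Data.Nat.Solver using (module +-*-Solver)
open import Data.Product.Base using (Σ; _×_; _,_; proj₁; proj₂)
open import Data.Unit.Base using (⊤; tt)
open import Function.Bundles using (_⇔_; mk⇔; Equivalence)
open import Relation.Binary.PropositionalEquality using (_≡_; refl; sym; trans; cong; cong₂; subst; module ≡-Reasoning)
open import Relation.Nullary.Decidable using (Dec; yes; _×-dec_)

open Algebra.Properties.CommutativeMonoid.Sum +-0-commutativeMonoid using (sum)

data PlaneTree : Set where
  node : List PlaneTree → PlaneTree

mutual
  size : PlaneTree → ℕ
  size (node ts) = suc (sizes ts)

  sizes : List PlaneTree → ℕ
  sizes []       = 0
  sizes (t ∷ ts) = size t + sizes ts

ColoringMatrix : ℕ → Set
ColoringMatrix m = Fin m → Fin m → Fin 2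

rowSum : ∀ {m} → ColoringMatrix m → Fin m → ℕ
rowSum A i = sum (λ j → toℕ (A i j))

RowSumsEqual : ∀ {m} → ColoringMatrix m → ℕ → Set
RowSumsEqual A r = ∀ i → rowSum A i ≡ r

-- An arbitrary assignment of a color to every vertex of the tree.
data Assignment (m : ℕ) : PlaneTree → Set where
  node : ∀ {ts} → Fin m → All (Assignment m) ts → Assignment m (node ts)

rootColor : ∀ {m t} → Assignment m t → Fin m
rootColor (node c _) = c

module _ {m : ℕ} (A : ColoringMatrix m) where

  mutual
    IsColoring : ∀ {t} → Assignment m t → Set
    IsColoring (node i κs) = ChildrenColored i κs

    ChildrenColored : ∀ {ts} → Fin m → All (Assignment m) ts → Set
    ChildrenColored i []       = ⊤
    ChildrenColored i (κ ∷ κs) = (A i (rootColor κ) ≡ 1F × IsColoring κ) × ChildrenColored i κs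

  mutual
    isColoring? : ∀ {t} (κ : Assignment m t) → Dec (IsColoring κ)
    isColoring? (node i κs) = childrenColored? i κs

    childrenColored? : ∀ {ts} (i : Fin m) (κs : All (Assignment m) ts) → Dec (ChildrenColored i κs)
    childrenColored? i []       = yes tt
    childrenColored? i (κ ∷ κs) = ((A i (rootColor κ) Fin.≟ 1F) ×-dec isColoring? κ) ×-dec childrenColored? i κs

-- All ordered forests with n vertices in total, provided n ≤ d; the first
-- argument d only serves to make the recursion structural.
forests : (d n : ℕ) → List (List PlaneTree)
forests d       zero    = [] ∷ []
forests zero    (suc n) = []
forests (suc d) (suc n) =
  concatMap (λ k → cartesianProductWith (λ ts us → node ts ∷ us) (forests d k) (forests d (n ∸ k))) (upTo (suc n))

planeTrees : ℕ → List PlaneTree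
planeTrees zero    = []
planeTrees (suc n) = map node (forests n n)

mutual
  assignments : ∀ m (t : PlaneTree) → List (Assignment m t)
  assignments m (node ts) = cartesianProductWith node (allFin m) (assignmentsAll m ts)

  assignmentsAll : ∀ m (ts : List PlaneTree) → List (All (Assignment m) ts)
  assignmentsAll m []       = [] ∷ []
  assignmentsAll m (t ∷ ts) = cartesianProductWith _∷_ (assignments m t) (assignmentsAll m ts)

coloredTrees : ∀ {m} → ColoringMatrix m → ℕ → List (Σ PlaneTree (Assignment m))
coloredTrees {m} A n = concatMap (λ t → map (t ,_) (filter (isColoring? A) (assignments m t))) (planeTrees n)

coloredTreesWithRoot : ∀ {m} → ColoringMatrix m → Fin m → ℕ → List (Σ PlaneTree (Assignment m))
coloredTreesWithRoot A i n = filter (λ p → rootColor (proj₂ p) Fin.≟ i) (coloredTrees A n)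

-- These are cardinalities because the two lists enumerate, without repetition,
-- exactly the pairs to be counted: see ∈-coloredTrees, coloredTrees-unique,
-- ∈-coloredTreesWithRoot and coloredTreesWithRoot-unique below.
treeCount : ∀ {m} → ColoringMatrix m → ℕ → ℕ
treeCount A n = length (coloredTrees A n)

treeCountWithRoot : ∀ {m} → ColoringMatrix m → Fin m → ℕ → ℕ
treeCountWithRoot A i n = length (coloredTreesWithRoot A i n)

-- The division is exact: see catalan-exact below.
catalan : ℕ → ℕ
catalan k = ((2 * k) C k) / suc k

Interchangeable : ∀ {m} → ColoringMatrix m → Fin m → Fin m → Set
Interchangeable A i j = ∀ n → n ≥ 1 → treeCountWithRoot A i n ≡ treeCountWithRoot A j n

StrictlyTreeColoringEquivalent : ∀ {m} → ColoringMatrix m → ColoringMatrix m → Set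
StrictlyTreeColoringEquivalent A B = ∀ n → n ≥ 1 → ∀ i → treeCountWithRoot A i n ≡ treeCountWithRoot B i n

private
  concatMap-unique : ∀ {a b} {X : Set a} {Y : Set b} (f : X → List Y) {xs} → Unique xs →
                     (∀ x → Unique (f x)) → (∀ {x x′ y} → y ∈ f x → y ∈ f x′ → x ≡ x′) →
                     Unique (concatMap f xs)
  concatMap-unique f {xs} xs! f! det = Unique.concat⁺
    (All.map⁺ (All.universal f! xs))
    (AllPairs.map⁺ (AllPairs.map (λ x≢x′ {_} (p , q) → x≢x′ (det p q)) xs!))

  node∷-injective : {ts ts′ us us′ : List PlaneTree} →
                    _≡_ {A = List PlaneTree} (node ts ∷ us) (node ts′ ∷ us′) → ts ≡ ts′ × us ≡ us′
  node∷-injective refl = refl , refl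

forests-sound : ∀ d n {ts} → ts ∈ forests d n → sizes ts ≡ n
forests-sound d       zero    (here refl) = refl
forests-sound (suc d) (suc n) p with find (∈-concatMap⁻ _ {xs = upTo (suc n)} p)
... | k , k∈ , q with ∈-cartesianProductWith⁻ _ (forests d k) (forests d (n ∸ k)) q
... | ts , us , ts∈ , us∈ , refl = cong suc (trans
  (cong₂ _+_ (forests-sound d k ts∈) (forests-sound d (n ∸ k) us∈))
  (m+[n∸m]≡n (≤-pred (∈-upTo⁻ k∈))))

forests-complete : ∀ d ts → sizes ts ≤ d → ts ∈ forests d (sizes ts)
forests-complete d       []             _        = here refl
forests-complete (suc d) (node ts ∷ us) (s≤s le) = ∈-concatMap⁺ _ (lose
  (∈-upTo⁺ (s≤s (m≤m+n (sizes ts) (sizes us))))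
  (∈-cartesianProductWith⁺ _
    (forests-complete d ts (≤-trans (m≤m+n (sizes ts) (sizes us)) le))
    (subst (λ k → us ∈ forests d k) (sym (m+n∸m≡n (sizes ts) (sizes us)))
      (forests-complete d us (≤-trans (m≤n+m (sizes us) (sizes ts)) le)))))

forests-unique : ∀ d n → Unique (forests d n)
forests-unique d       zero    = [] ∷ []
forests-unique zero    (suc n) = []
forests-unique (suc d) (suc n) = concatMap-unique _ (Unique.upTo⁺ (suc n))
  (λ k → Unique.cartesianProductWith⁺ _ node∷-injective (forests-unique d k) (forests-unique d (n ∸ k)))
  det
  where
  det : ∀ {k k′ ts} →
        ts ∈ cartesianProductWith (λ ts us → node ts ∷ us) (forests d k) (forests d (n ∸ k)) →
        ts ∈ cartesianProductWith (λ ts us → node ts ∷ us) (forests d k′) (forests d (n ∸ k′)) →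
        k ≡ k′
  det {k} {k′} p q with ∈-cartesianProductWith⁻ _ (forests d k) (forests d (n ∸ k)) p
                      | ∈-cartesianProductWith⁻ _ (forests d k′) (forests d (n ∸ k′)) q
  ... | _ , _ , ts∈ , _ , refl | _ , _ , ts∈′ , _ , refl =
    trans (sym (forests-sound d k ts∈)) (forests-sound d k′ ts∈′)

∈-planeTrees : ∀ {n t} → t ∈ planeTrees n ⇔ size t ≡ n
∈-planeTrees {n} {t} = mk⇔ (to n) (from n t)
  where
  to : ∀ n {t} → t ∈ planeTrees n → size t ≡ n
  to (suc n) p with ∈-map⁻ node p
  ... | _ , q , refl = cong suc (forests-sound n n q)

  from : ∀ n t → size t ≡ n → t ∈ planeTrees n
  from _ (node ts) refl = ∈-map⁺ node (forests-complete (sizes ts) ts ≤-refl)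

planeTrees-unique : ∀ n → Unique (planeTrees n)
planeTrees-unique zero    = []
planeTrees-unique (suc n) = Unique.map⁺ (λ { refl → refl }) (forests-unique n n)

mutual
  assignments-complete : ∀ {m t} (κ : Assignment m t) → κ ∈ assignments m t
  assignments-complete (node c κs) = ∈-cartesianProductWith⁺ node (∈-allFin c) (assignmentsAll-complete κs)

  assignmentsAll-complete : ∀ {m ts} (κs : All (Assignment m) ts) → κs ∈ assignmentsAll m ts
  assignmentsAll-complete []       = here refl
  assignmentsAll-complete (κ ∷ κs) =
    ∈-cartesianProductWith⁺ _∷_ (assignments-complete κ) (assignmentsAll-complete κs)

mutual
  assignments-unique : ∀ m t → Unique (assignments m t)
  assignments-unique m (node ts) = Unique.cartesianProductWith⁺ node (λ { refl → refl , refl })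
    (Unique.allFin⁺ m) (assignmentsAll-unique m ts)

  assignmentsAll-unique : ∀ m ts → Unique (assignmentsAll m ts)
  assignmentsAll-unique m []       = [] ∷ []
  assignmentsAll-unique m (t ∷ ts) = Unique.cartesianProductWith⁺ _∷_ (λ { refl → refl , refl })
    (assignments-unique m t) (assignmentsAll-unique m ts)

module _ {m : ℕ} (A : ColoringMatrix m) where

  ∈-coloredTrees : ∀ {n t} {κ : Assignment m t} →
                   (t , κ) ∈ coloredTrees A n ⇔ (size t ≡ n × IsColoring A κ)
  ∈-coloredTrees {n} {t} {κ} = mk⇔ to from
    where
    to : (t , κ) ∈ coloredTrees A n → size t ≡ n × IsColoring A κ
    to p with find (∈-concatMap⁻ _ {xs = planeTrees n} p)
    ... | t , t∈ , q with ∈-map⁻ (t ,_) q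
    ... | κ , κ∈ , refl = Equivalence.to ∈-planeTrees t∈ , proj₂ (∈-filter⁻ (isColoring? A) {xs = assignments m t} κ∈)

    from : size t ≡ n × IsColoring A κ → (t , κ) ∈ coloredTrees A n
    from (eq , ok) = ∈-concatMap⁺ _ (lose (Equivalence.from ∈-planeTrees eq)
      (∈-map⁺ (t ,_) (∈-filter⁺ (isColoring? A) (assignments-complete κ) ok)))

  coloredTrees-unique : ∀ n → Unique (coloredTrees A n)
  coloredTrees-unique n = concatMap-unique _ (planeTrees-unique n)
    (λ t → Unique.map⁺ (λ { refl → refl }) (Unique.filter⁺ (isColoring? A) (assignments-unique m t)))
    det
    where
    det : ∀ {t t′ p} → p ∈ map (t ,_) (filter (isColoring? A) (assignments m t)) →
          p ∈ map (t′ ,_) (filter (isColoring? A) (assignments m t′)) → t ≡ t′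
    det p q with ∈-map⁻ _ p | ∈-map⁻ _ q
    ... | _ , _ , refl | _ , _ , refl = refl

  ∈-coloredTreesWithRoot : ∀ {i n t} {κ : Assignment m t} →
    (t , κ) ∈ coloredTreesWithRoot A i n ⇔ ((size t ≡ n × IsColoring A κ) × rootColor κ ≡ i)
  ∈-coloredTreesWithRoot {i} {n} = mk⇔
    (λ p → let q , eq = ∈-filter⁻ root? {xs = coloredTrees A n} p in Equivalence.to ∈-coloredTrees q , eq)
    (λ (q , eq) → ∈-filter⁺ root? (Equivalence.from ∈-coloredTrees q) eq)
    where
    root? : (p : Σ PlaneTree (Assignment m)) → Dec (rootColor (proj₂ p) ≡ i)
    root? p = rootColor (proj₂ p) Fin.≟ i

  coloredTreesWithRoot-unique : ∀ i n → Unique (coloredTreesWithRoot A i n)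
  coloredTreesWithRoot-unique i n = Unique.filter⁺ (λ p → rootColor (proj₂ p) Fin.≟ i) (coloredTrees-unique n)

private
  open ≡-Reasoning

  absorption : ∀ n k → suc k * (suc n C suc k) ≡ suc n * (n C k)
  absorption zero    zero    = refl
  absorption zero    (suc k) = begin
    suc (suc k) * (1 C suc (suc k)) ≡⟨ cong (suc (suc k) *_) (k>n⇒nCk≡0 {1} {suc (suc k)} (s≤s (s≤s z≤n))) ⟩
    suc (suc k) * 0                 ≡⟨ *-zeroʳ (suc (suc k)) ⟩
    1 * 0                           ≡⟨ cong (1 *_) (k>n⇒nCk≡0 {0} {suc k} (s≤s z≤n)) ⟨
    1 * (0 C suc k)                 ∎
  absorption (suc n) zero    = begin
    1 * (suc (suc n) C 1)       ≡⟨ +-identityʳ _ ⟩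
    suc (suc n) C 1             ≡⟨ nC1≡n (suc (suc n)) ⟩
    suc (suc n)                 ≡⟨ *-identityʳ (suc (suc n)) ⟨
    suc (suc n) * 1             ≡⟨ cong (suc (suc n) *_) (n-C-0 (suc n)) ⟨
    suc (suc n) * (suc n C 0)   ∎
    where
    n-C-0 : ∀ n → n C 0 ≡ 1
    n-C-0 n = +-cancelʳ-≡ (n C 1) (n C 0) 1 (begin
      n C 0 + n C 1 ≡⟨ nCk+nC[k+1]≡[n+1]C[k+1] n 0 ⟩
      suc n C 1     ≡⟨ nC1≡n (suc n) ⟩
      suc n         ≡⟨ cong suc (nC1≡n n) ⟨
      1 + n C 1     ∎)
  absorption (suc n) (suc k) = begin
    suc (suc k) * (suc (suc n) C suc (suc k))
      ≡⟨ cong (suc (suc k) *_) (nCk+nC[k+1]≡[n+1]C[k+1] (suc n) (suc k)) ⟨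
    suc (suc k) * (b + c)
      ≡⟨ solve 3 (λ k b c → (con 2 :+ k) :* (b :+ c) := b :+ ((con 1 :+ k) :* b :+ (con 2 :+ k) :* c)) refl k b c ⟩
    b + (suc k * b + suc (suc k) * c)
      ≡⟨ cong (b +_) (cong₂ _+_ (absorption n k) (absorption n (suc k))) ⟩
    b + (suc n * (n C k) + suc n * (n C suc k))
      ≡⟨ cong (b +_) (*-distribˡ-+ (suc n) (n C k) (n C suc k)) ⟨
    b + suc n * (n C k + n C suc k)
      ≡⟨ cong (λ x → b + suc n * x) (nCk+nC[k+1]≡[n+1]C[k+1] n k) ⟩
    suc (suc n) * b ∎
    where
    open +-*-Solver
    b = suc n C suc k
    c = suc n C suc (suc k)

catalan-exact : ∀ k → suc k * catalan k ≡ (2 * k) C k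
catalan-exact k = m*[n/m]≡n (divides (x ∸ y) (sym (begin
  (x ∸ y) * suc k           ≡⟨ *-comm (x ∸ y) (suc k) ⟩
  suc k * (x ∸ y)           ≡⟨ *-distribˡ-∸ (suc k) x y ⟩
  suc k * x ∸ suc k * y     ≡⟨ cong (suc k * x ∸_) [1+k]y≡kx ⟩
  (x + k * x) ∸ k * x       ≡⟨ m+n∸n≡m x (k * x) ⟩
  x                         ∎)))
  where
  x = (2 * k) C k
  y = (2 * k) C suc k

  [1+k]y≡kx : suc k * y ≡ k * x
  [1+k]y≡kx = +-cancelʳ-≡ (suc k * x) (suc k * y) (k * x) (begin
    suc k * y + suc k * x           ≡⟨ +-comm (suc k * y) (suc k * x) ⟩
    suc k * x + suc k * y           ≡⟨ *-distribˡ-+ (suc k) x y ⟨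
    suc k * (x + y)                 ≡⟨ cong (suc k *_) (nCk+nC[k+1]≡[n+1]C[k+1] (2 * k) k) ⟩
    suc k * (suc (2 * k) C suc k)   ≡⟨ absorption (2 * k) k ⟩
    suc (2 * k) * x                 ≡⟨ solve 2 (λ k x → (con 1 :+ con 2 :* k) :* x := k :* x :+ (con 1 :+ k) :* x) refl k x ⟩
    k * x + suc k * x               ∎)
    where open +-*-Solver

{-# OPTIONS --safe #-}

-- Once the color of a vertex is fixed, each of its children can be colored in
-- exactly r ways, so every plane tree with n vertices has r ^ (n ∸ 1) colorings
-- with a prescribed root color, independently of its shape.  It remains to
-- count plane trees.  The enumeration of forests gives the recurrence
-- c (n + 1) = Σ c k * c (n - k).  Conversely, the closed form satisfies
-- (n + 2) * c (n + 1) = (4 n + 2) * c n; convolving this relation with c, and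
-- using Σ k * c k * c (n - k) = (n / 2) * Σ c k * c (n - k), which holds by
-- symmetry, gives the same recurrence by induction on n.
module Submission where

open import Defs
import Algebra.Properties.CommutativeMonoid.Sum
open import Data.Fin.Base using (Fin; zero; suc; toℕ)
open import Data.Fin.Patterns using (0F; 1F)
import Data.Fin.Properties as Fin
open import Data.List.Base using (List; []; _∷_; _++_; map; filter; length; concatMap; cartesianProductWith; allFin; upTo; applyUpTo; tabulate)
open import Data.List.Membership.Propositional using (_∈_)
open import Data.List.Membership.Propositional.Properties using (∈-allFin)
open import Data.List.Properties using (length-++; length-map; length-tabulate; map-upTo; map-cong-local; filter-all; filter-none; filter-accept; filter-reject; filter-≐; filter-++)
open import Data.List.Relation.Unary.All as All using (All; []; _∷_)
import Data.List.Relation.Unary.All.Properties as All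
open import Data.List.Relation.Unary.AllPairs using (_∷_)
open import Data.List.Relation.Unary.Any using (here; there)
open import Data.List.Relation.Unary.Unique.Propositional using (Unique)
import Data.List.Relation.Unary.Unique.Propositional.Properties as Unique
open import Data.Bool.Base using (true; false)
open import Data.Nat.Base using (ℕ; zero; suc; _+_; _*_; _∸_; _^_; _≤_; _≥_; _!; s≤s)
open import Data.Nat.Combinatorics using (_C_; nCk≡n!/k![n-k]!; k![n∸k]!∣n!)
open import Data.Nat.DivMod using (m/n*n≡m)
open import Data.Nat.ListAction using (sum)
open import Data.Nat.Properties using (_!*_!≢0; *-cancelˡ-≡; *-cancelʳ-≡; *-comm; *-zeroʳ; +-assoc; +-identityʳ; +-suc; ^-distribˡ-+-*; m+n∸m≡n; m∸n≤m; m≤m+n; ≤-pred; ≤-refl; ≤-trans; +-0-commutativeMonoid)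
open import Data.Nat.Solver using (module +-*-Solver)
open import Data.Product.Base using (Σ; _×_; _,_; proj₁; proj₂; swap)
open import Data.Unit.Base using (tt)
open import Function.Base using (_∘_)
open import Function.Bundles using (_⇔_; mk⇔; Equivalence)
open import Level using (Level)
open import Relation.Binary.Definitions using (DecidableEquality)
open import Relation.Binary.PropositionalEquality using (_≡_; _≗_; refl; sym; trans; cong; cong₂; module ≡-Reasoning)
open import Relation.Nullary.Decidable using (yes; no; does; _×-dec_)
open import Relation.Unary using (Pred; Decidable)
open import Relation.Unary.Properties using (U?)

open Algebra.Properties.CommutativeMonoid.Sum +-0-commutativeMonoid using () renaming (sum to ∑)
open +-*-Solver using (solve; con; _:+_; _:*_; _:=_)
open ≡-Reasoning

private
  variable
    a b c p q s : Level
    X : Set a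
    Y : Set b
    Z : Set c

-- Lengths of filtered lists and products

length-concatMap : (f : X → List Y) → ∀ xs → length (concatMap f xs) ≡ sum (map (length ∘ f) xs)
length-concatMap f []       = refl
length-concatMap f (x ∷ xs) =
  trans (length-++ (f x)) (cong (length (f x) +_) (length-concatMap f xs))

length-concatMap-const : (f : X → List Y) → ∀ xs {k} → All (λ x → length (f x) ≡ k) xs →
                         length (concatMap f xs) ≡ length xs * k
length-concatMap-const f []       []         = refl
length-concatMap-const f (x ∷ xs) (eq ∷ eqs) =
  trans (length-++ (f x)) (cong₂ _+_ eq (length-concatMap-const f xs eqs))

length-cartesianProductWith : (f : X → Y → Z) → ∀ xs ys →
                              length (cartesianProductWith f xs ys) ≡ length xs * length ys
length-cartesianProductWith f []       ys = refl
length-cartesianProductWith f (x ∷ xs) ys =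
  trans (length-++ (map (f x) ys)) (cong₂ _+_ (length-map (f x) ys) (length-cartesianProductWith f xs ys))

module _ {P : Pred Y p} (P? : Decidable P) where

  filter-map : (f : X → Y) → ∀ xs → filter P? (map f xs) ≡ map f (filter (P? ∘ f) xs)
  filter-map f []       = refl
  filter-map f (x ∷ xs) with ih ← filter-map f xs | does (P? (f x))
  ... | true  = cong (f x ∷_) ih
  ... | false = ih

  length-filter-map : (f : X → Y) → ∀ xs → length (filter P? (map f xs)) ≡ length (filter (P? ∘ f) xs)
  length-filter-map f xs = trans (cong length (filter-map f xs)) (length-map f (filter (P? ∘ f) xs))

  filter-concatMap : (f : X → List Y) → ∀ xs → filter P? (concatMap f xs) ≡ concatMap (filter P? ∘ f) xs
  filter-concatMap f []       = refl
  filter-concatMap f (x ∷ xs) =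
    trans (filter-++ P? (f x) (concatMap f xs)) (cong (filter P? (f x) ++_) (filter-concatMap f xs))

  filter-filter : {Q : Pred Y q} (Q? : Decidable Q) → ∀ xs →
                  filter P? (filter Q? xs) ≡ filter (λ x → Q? x ×-dec P? x) xs
  filter-filter Q? []       = refl
  filter-filter Q? (x ∷ xs) with ih ← filter-filter Q? xs | does (Q? x)
  ... | false = ih
  ... | true with does (P? x)
  ...   | true  = cong (x ∷_) ih
  ...   | false = ih

-- Product rule for dependent choices: the condition `R x` on the second factor may vary with `x`,
-- but every admissible `x` leaves the same number `k` of choices. For colorings, `x` is a root
-- color or a first subtree.
length-filter-cartesianProductWith :
  {f : X → Y → Z} {P : Pred Z p} {Q : Pred X q} {R : X → Pred Y s} →
  (P? : Decidable P) (Q? : Decidable Q) (R? : ∀ x → Decidable (R x)) →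
  (∀ x y → P (f x y) ⇔ (Q x × R x y)) →
  ∀ xs ys {k} → (∀ x → Q x → length (filter (R? x) ys) ≡ k) →
  length (filter P? (cartesianProductWith f xs ys)) ≡ length (filter Q? xs) * k
length-filter-cartesianProductWith P? Q? R? P⇔Q×R [] ys eq = refl
length-filter-cartesianProductWith {f = f} P? Q? R? P⇔Q×R (x ∷ xs) ys {k} eq = begin
  length (filter P? (map (f x) ys ++ zs))
    ≡⟨ cong length (filter-++ P? (map (f x) ys) zs) ⟩
  length (filter P? (map (f x) ys) ++ filter P? zs)
    ≡⟨ length-++ (filter P? (map (f x) ys)) ⟩
  length (filter P? (map (f x) ys)) + length (filter P? zs)
    ≡⟨ cong₂ _+_ (length-filter-map P? (f x) ys)
                 (length-filter-cartesianProductWith P? Q? R? P⇔Q×R xs ys eq) ⟩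
  length (filter (P? ∘ f x) ys) + length (filter Q? xs) * k
    ≡⟨ row ⟩
  length (filter Q? (x ∷ xs)) * k ∎
  where
  zs = cartesianProductWith f xs ys

  row : length (filter (P? ∘ f x) ys) + length (filter Q? xs) * k ≡ length (filter Q? (x ∷ xs)) * k
  -- An admissible head `x` contributes a row of `k` elements, an inadmissible one an empty row.
  row with Q? x
  ... | yes Qx = cong (_+ length (filter Q? xs) * k) (trans
    (cong length (filter-≐ (P? ∘ f x) (R? x)
      ((λ {y} Py → proj₂ (Equivalence.to (P⇔Q×R x y) Py)) , λ {y} Ry → Equivalence.from (P⇔Q×R x y) (Qx , Ry)) ys))
    (eq x Qx))
  ... | no ¬Qx = cong (λ zs → length zs + length (filter Q? xs) * k)
    (filter-none (P? ∘ f x) (All.universal (λ y Py → ¬Qx (proj₁ (Equivalence.to (P⇔Q×R x y) Py))) ys))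

length-filter-≟ : (_≟_ : DecidableEquality X) → ∀ {x xs} → Unique xs → x ∈ xs →
                  length (filter (_≟ x) xs) ≡ 1
length-filter-≟ _≟_ {x} (x∉xs ∷ _) (here refl) = cong length (trans
  (filter-accept (_≟ x) refl)
  (cong (x ∷_) (filter-none (_≟ x) (All.map (λ x≢y y≡x → x≢y (sym y≡x)) x∉xs))))
length-filter-≟ _≟_ {x} (y∉xs ∷ xs!) (there x∈xs) = trans
  (cong length (filter-reject (_≟ x) (All.lookup y∉xs x∈xs)))
  (length-filter-≟ _≟_ xs! x∈xs)

-- An entry in `Fin 2`, read as a number, is the indicator of being `1F`, so the permitted child
-- colors are counted by the row sum. A general `tabulate g` replaces `allFin` because the tail of
-- `allFin` is no longer of that form.
length-filter-≟1 : (h : X → Fin 2) → ∀ {n} (g : Fin n → X) →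
                   length (filter (λ x → h x Fin.≟ 1F) (tabulate g)) ≡ ∑ (λ j → toℕ (h (g j)))
length-filter-≟1 h {zero}  g = refl
length-filter-≟1 h {suc n} g with h (g zero)
... | 0F = length-filter-≟1 h (g ∘ suc)
... | 1F = cong suc (length-filter-≟1 h (g ∘ suc))

-- Colorings of a fixed tree

module _ {m r : ℕ} (A : ColoringMatrix m) (rows : RowSumsEqual A r) where

  -- Every vertex of the forest, roots included, has a parent whose color is chosen before its own,
  -- and so has `r` options. The result is independent of `i`, which is what lets the product rule
  -- apply one level up.
  length-childrenColored : ∀ i ts → length (filter (childrenColored? A i) (assignmentsAll m ts)) ≡ r ^ sizes ts
  length-childrenColored i []             = refl
  length-childrenColored i (node us ∷ ts) = begin
    length (filter (childrenColored? A i) (assignmentsAll m (node us ∷ ts)))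
      ≡⟨ length-filter-cartesianProductWith (childrenColored? A i) child? (λ _ → childrenColored? A i)
           (λ _ _ → mk⇔ (λ x → x) (λ x → x)) (assignments m (node us)) (assignmentsAll m ts)
           (λ _ _ → length-childrenColored i ts) ⟩
    length (filter child? (assignments m (node us))) * r ^ sizes ts
      -- The root color `c` of the first tree is chosen first; whatever it is, its subforest `us`
      -- can then be colored in `r ^ sizes us` ways.
      ≡⟨ cong (_* r ^ sizes ts) (length-filter-cartesianProductWith child? (λ c → A i c Fin.≟ 1F) (childrenColored? A)
           (λ _ _ → mk⇔ (λ x → x) (λ x → x)) (allFin m) (assignmentsAll m us)
           (λ c _ → length-childrenColored c us)) ⟩
    length (filter (λ c → A i c Fin.≟ 1F) (allFin m)) * r ^ sizes us * r ^ sizes ts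
      ≡⟨ cong (λ x → x * r ^ sizes us * r ^ sizes ts) (trans (length-filter-≟1 (A i) (λ c → c)) (rows i)) ⟩
    r ^ size (node us) * r ^ sizes ts
      ≡⟨ ^-distribˡ-+-* r (size (node us)) (sizes ts) ⟨
    r ^ sizes (node us ∷ ts) ∎
    where
    child? : Decidable (λ (κ : Assignment m (node us)) → A i (rootColor κ) ≡ 1F × IsColoring A κ)
    child? κ = (A i (rootColor κ) Fin.≟ 1F) ×-dec isColoring? A κ

  length-colorings : ∀ t → length (filter (isColoring? A) (assignments m t)) ≡ m * r ^ (size t ∸ 1)
  length-colorings (node ts) = begin
    length (filter (isColoring? A) (assignments m (node ts)))
      -- The root color is unconstrained, so the always-true predicate serves as the condition on
      -- the first factor.
      ≡⟨ length-filter-cartesianProductWith (isColoring? A) U? (childrenColored? A)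
           (λ _ _ → mk⇔ (tt ,_) proj₂) (allFin m) (assignmentsAll m ts)
           (λ c _ → length-childrenColored c ts) ⟩
    length (filter U? (allFin m)) * r ^ sizes ts
      ≡⟨ cong (λ cs → length cs * r ^ sizes ts) (filter-all U? (All.universal (λ _ → tt) (allFin m))) ⟩
    length (allFin m) * r ^ sizes ts
      ≡⟨ cong (_* r ^ sizes ts) (length-tabulate {n = m} (λ c → c)) ⟩
    m * r ^ sizes ts ∎

  length-coloringsWithRoot : ∀ i t →
    length (filter (λ κ → isColoring? A κ ×-dec (rootColor κ Fin.≟ i)) (assignments m t)) ≡ r ^ (size t ∸ 1)
  length-coloringsWithRoot i (node ts) = begin
    length (filter (λ κ → isColoring? A κ ×-dec (rootColor κ Fin.≟ i)) (assignments m (node ts)))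
      ≡⟨ length-filter-cartesianProductWith
           (λ κ → isColoring? A κ ×-dec (rootColor κ Fin.≟ i)) (Fin._≟ i) (childrenColored? A)
           -- The product rule wants the condition on the root color first.
           (λ _ _ → mk⇔ swap swap) (allFin m) (assignmentsAll m ts)
           (λ c _ → length-childrenColored c ts) ⟩
    length (filter (Fin._≟ i) (allFin m)) * r ^ sizes ts
      ≡⟨ cong (_* r ^ sizes ts) (length-filter-≟ Fin._≟_ (Unique.allFin⁺ m) (∈-allFin i)) ⟩
    1 * r ^ sizes ts
      ≡⟨ +-identityʳ (r ^ sizes ts) ⟩
    r ^ sizes ts ∎

  -- Summation over all plane trees of a given size

  coloringsOf : (t : PlaneTree) → List (Σ PlaneTree (Assignment m))
  coloringsOf t = map (t ,_) (filter (isColoring? A) (assignments m t))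

  root? : ∀ i → Decidable (λ (p : Σ PlaneTree (Assignment m)) → rootColor (proj₂ p) ≡ i)
  root? i p = rootColor (proj₂ p) Fin.≟ i

  treeCount≡ : ∀ n → treeCount A n ≡ length (planeTrees n) * (m * r ^ (n ∸ 1))
  treeCount≡ n = length-concatMap-const coloringsOf (planeTrees n) (All.tabulate λ {t} t∈ → begin
    length (coloringsOf t)
      ≡⟨ length-map {B = Σ PlaneTree (Assignment m)} (t ,_) (filter (isColoring? A) (assignments m t)) ⟩
    length (filter (isColoring? A) (assignments m t))
      ≡⟨ length-colorings t ⟩
    m * r ^ (size t ∸ 1)
      ≡⟨ cong (λ k → m * r ^ (k ∸ 1)) (Equivalence.to (∈-planeTrees {n}) t∈) ⟩
    m * r ^ (n ∸ 1) ∎)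

  -- The root filter is pushed inside the concatenation and merged with the coloring filter; each
  -- tree then contributes the same amount, since its size is `n`.
  treeCountWithRoot≡ : ∀ i n → treeCountWithRoot A i n ≡ length (planeTrees n) * r ^ (n ∸ 1)
  treeCountWithRoot≡ i n = trans
    (cong length (filter-concatMap (root? i) coloringsOf (planeTrees n)))
    (length-concatMap-const (filter (root? i) ∘ coloringsOf) (planeTrees n) (All.tabulate λ {t} t∈ → begin
      length (filter (root? i) (coloringsOf t))
        ≡⟨ length-filter-map (root? i) (t ,_) (filter (isColoring? A) (assignments m t)) ⟩
      length (filter (λ κ → rootColor κ Fin.≟ i) (filter (isColoring? A) (assignments m t)))
        ≡⟨ cong length (filter-filter (λ κ → rootColor κ Fin.≟ i) (isColoring? A) (assignments m t)) ⟩
      length (filter (λ κ → isColoring? A κ ×-dec (rootColor κ Fin.≟ i)) (assignments m t))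
        ≡⟨ length-coloringsWithRoot i t ⟩
      r ^ (size t ∸ 1)
        ≡⟨ cong (λ k → r ^ (k ∸ 1)) (Equivalence.to (∈-planeTrees {n}) t∈) ⟩
      r ^ (n ∸ 1) ∎))

-- Convolutions

-- The Cauchy product, with `n + 1` terms. Through `applyUpTo`, the value at `suc n` computes to
-- `f 0 * g (suc n)` plus the convolution of `f ∘ suc` with `g` at `n`; the inductions below rest on
-- this.
convolution : (ℕ → ℕ) → (ℕ → ℕ) → ℕ → ℕ
convolution f g n = sum (applyUpTo (λ k → f k * g (n ∸ k)) (suc n))

convolution-congˡ : ∀ {f f′} g → f ≗ f′ → convolution f g ≗ convolution f′ g
convolution-congˡ g f≗f′ zero    = cong (λ x → x * g 0 + 0) (f≗f′ 0)
convolution-congˡ g f≗f′ (suc n) =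
  cong₂ _+_ (cong (_* g (suc n)) (f≗f′ 0)) (convolution-congˡ g (f≗f′ ∘ suc) n)

convolution-distribʳ-+ : ∀ f f′ g n →
  convolution (λ k → f k + f′ k) g n ≡ convolution f g n + convolution f′ g n
convolution-distribʳ-+ f f′ g zero    =
  solve 3 (λ x y z → (x :+ y) :* z :+ con 0 := x :* z :+ con 0 :+ (y :* z :+ con 0)) refl (f 0) (f′ 0) (g 0)
convolution-distribʳ-+ f f′ g (suc n) = trans
  (cong ((f 0 + f′ 0) * g (suc n) +_) (convolution-distribʳ-+ (f ∘ suc) (f′ ∘ suc) g n))
  (solve 5 (λ x y z u v → (x :+ y) :* z :+ (u :+ v) := x :* z :+ u :+ (y :* z :+ v)) refl
    (f 0) (f′ 0) (g (suc n)) (convolution (f ∘ suc) g n) (convolution (f′ ∘ suc) g n))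

convolution-*ˡ : ∀ l f g n → convolution (λ k → l * f k) g n ≡ l * convolution f g n
convolution-*ˡ l f g zero    =
  solve 3 (λ l x z → l :* x :* z :+ con 0 := l :* (x :* z :+ con 0)) refl l (f 0) (g 0)
convolution-*ˡ l f g (suc n) = trans
  (cong (l * f 0 * g (suc n) +_) (convolution-*ˡ l (f ∘ suc) g n))
  (solve 4 (λ l x z u → l :* x :* z :+ l :* u := l :* (x :* z :+ u)) refl
    l (f 0) (g (suc n)) (convolution (f ∘ suc) g n))

-- Unfolding the definition detaches the term `k = 0`; this detaches the last one, as reversing the
-- sum requires.
convolution-splitʳ : ∀ f g n →
  convolution f g (suc n) ≡ convolution f (g ∘ suc) n + f (suc n) * g 0
convolution-splitʳ f g zero    =
  solve 2 (λ x y → x :+ (y :+ con 0) := x :+ con 0 :+ y) refl (f 0 * g 1) (f 1 * g 0)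
convolution-splitʳ f g (suc n) = trans
  (cong (f 0 * g (suc (suc n)) +_) (convolution-splitʳ (f ∘ suc) g n))
  (sym (+-assoc (f 0 * g (suc (suc n))) (convolution (f ∘ suc) (g ∘ suc) n) _))

convolution-comm : ∀ f g n → convolution f g n ≡ convolution g f n
convolution-comm f g zero    = cong (_+ 0) (*-comm (f 0) (g 0))
convolution-comm f g (suc n) = begin
  f 0 * g (suc n) + convolution (f ∘ suc) g n
    ≡⟨ cong (f 0 * g (suc n) +_) (convolution-comm (f ∘ suc) g n) ⟩
  f 0 * g (suc n) + convolution g (f ∘ suc) n
    ≡⟨ solve 3 (λ x y u → x :* y :+ u := u :+ y :* x) refl (f 0) (g (suc n)) (convolution g (f ∘ suc) n) ⟩
  convolution g (f ∘ suc) n + g (suc n) * f 0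
    ≡⟨ convolution-splitʳ g f n ⟨
  convolution g f (suc n) ∎

-- The Leibniz rule for the derivation f ↦ (λ k → k * f k).
convolution-leibniz : ∀ f g n →
  convolution (λ k → k * f k) g n + convolution f (λ k → k * g k) n ≡ n * convolution f g n
convolution-leibniz f g zero    = cong (_+ 0) (*-zeroʳ (f 0))
convolution-leibniz f g (suc n) = begin
  convolution (λ k → f (suc k) + k * f (suc k)) g n + (f 0 * (suc n * g (suc n)) + v)
    ≡⟨ cong (_+ (f 0 * (suc n * g (suc n)) + v))
            (convolution-distribʳ-+ (f ∘ suc) (λ k → k * f (suc k)) g n) ⟩
  w + u + (f 0 * (suc n * g (suc n)) + v)
    ≡⟨ solve 6 (λ n x y u v w → w :+ u :+ (x :* ((con 1 :+ n) :* y) :+ v)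
                              := (con 1 :+ n) :* (x :* y) :+ w :+ (u :+ v))
         refl n (f 0) (g (suc n)) u v w ⟩
  suc n * (f 0 * g (suc n)) + w + (u + v)
    ≡⟨ cong (suc n * (f 0 * g (suc n)) + w +_) (convolution-leibniz (f ∘ suc) g n) ⟩
  suc n * (f 0 * g (suc n)) + w + n * w
    ≡⟨ solve 3 (λ n x w → (con 1 :+ n) :* x :+ w :+ n :* w := (con 1 :+ n) :* (x :+ w))
         refl n (f 0 * g (suc n)) w ⟩
  suc n * convolution f g (suc n) ∎
  where
  u = convolution (λ k → k * f (suc k)) g n
  v = convolution (f ∘ suc) (λ k → k * g k) n
  w = convolution (f ∘ suc) g n

-- For equal factors, commutativity makes the two terms of the Leibniz rule coincide.
2*convolution-self : ∀ f n → 2 * convolution (λ k → k * f k) f n ≡ n * convolution f f n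
2*convolution-self f n = begin
  2 * convolution (λ k → k * f k) f n
    ≡⟨ cong (convolution (λ k → k * f k) f n +_) (trans (+-identityʳ _) (convolution-comm (λ k → k * f k) f n)) ⟩
  convolution (λ k → k * f k) f n + convolution f (λ k → k * f k) n
    ≡⟨ convolution-leibniz f f n ⟩
  n * convolution f f n ∎

-- Catalan numbers

centralBinomial-factorial : ∀ n → ((2 * n) C n) * (n ! * n !) ≡ (2 * n) !
centralBinomial-factorial n = begin
  ((2 * n) C n) * (n ! * n !)
    ≡⟨ cong (λ k → ((2 * n) C n) * (n ! * k !)) (trans (m+n∸m≡n n (n + 0)) (+-identityʳ n)) ⟨
  ((2 * n) C n) * (n ! * (2 * n ∸ n) !)
    ≡⟨ cong (_* (n ! * (2 * n ∸ n) !)) (nCk≡n!/k![n-k]! n≤2n) ⟩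
  _ ≡⟨ m/n*n≡m (k![n∸k]!∣n! n≤2n) ⟩
  (2 * n) ! ∎
  where
  n≤2n = m≤m+n n (n + 0)
  instance _ = n !* (2 * n ∸ n) !≢0

-- Multiplied by `suc n * (n ! * n !)`, both sides become `(2 * suc n) !`, and the factor cancels.
centralBinomial-suc : ∀ n → suc n * ((2 * suc n) C suc n) ≡ (2 + 4 * n) * ((2 * n) C n)
centralBinomial-suc n = *-cancelˡ-≡ _ _ (suc n) (*-cancelʳ-≡ _ _ (n ! * n !) (begin
  suc n * (suc n * ((2 * suc n) C suc n)) * (n ! * n !)
    ≡⟨ solve 3 (λ k x y → k :* (k :* x) :* (y :* y) := x :* (k :* y :* (k :* y)))
         refl (suc n) ((2 * suc n) C suc n) (n !) ⟩
  ((2 * suc n) C suc n) * (suc n ! * suc n !)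
    ≡⟨ centralBinomial-factorial (suc n) ⟩
  (2 * suc n) !
    ≡⟨ cong (λ k → suc k !) (+-suc n (n + 0)) ⟩
  suc (suc (2 * n)) * (suc (2 * n) * (2 * n) !)
    ≡⟨ cong (λ x → suc (suc (2 * n)) * (suc (2 * n) * x)) (centralBinomial-factorial n) ⟨
  suc (suc (2 * n)) * (suc (2 * n) * (((2 * n) C n) * (n ! * n !)))
    ≡⟨ solve 3 (λ n x y → (con 2 :+ con 2 :* n) :* ((con 1 :+ con 2 :* n) :* (x :* y))
                        := (con 1 :+ n) :* ((con 2 :+ con 4 :* n) :* x) :* y)
         refl n ((2 * n) C n) (n ! * n !) ⟩
  suc n * ((2 + 4 * n) * ((2 * n) C n)) * (n ! * n !) ∎))
  where instance _ = n !* n !≢0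

-- A further factor `suc n` turns both sides into multiples of central binomial coefficients, by
-- exactness of the division in `catalan`.
catalan-suc : ∀ n → (2 + n) * catalan (suc n) ≡ (2 + 4 * n) * catalan n
catalan-suc n = *-cancelˡ-≡ _ _ (suc n) (begin
  suc n * ((2 + n) * catalan (suc n))       ≡⟨ cong (suc n *_) (catalan-exact (suc n)) ⟩
  suc n * ((2 * suc n) C suc n)             ≡⟨ centralBinomial-suc n ⟩
  (2 + 4 * n) * ((2 * n) C n)               ≡⟨ cong ((2 + 4 * n) *_) (catalan-exact n) ⟨
  (2 + 4 * n) * (suc n * catalan n)         ≡⟨ solve 3 (λ x y z → x :* (y :* z) := y :* (x :* z))
                                                 refl (2 + 4 * n) (suc n) (catalan n) ⟩
  suc n * ((2 + 4 * n) * catalan n)         ∎)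

catalan-convolution : ∀ n → convolution catalan catalan n ≡ catalan (suc n)
catalan-convolution zero    = refl
-- The factor `3 + n` is the left coefficient of `catalan-suc` at `suc n`, which closes the chain.
catalan-convolution (suc n) = *-cancelˡ-≡ _ _ (3 + n) (begin
  (3 + n) * S (suc n)
    ≡⟨ solve 2 (λ n s → (con 3 :+ n) :* s := con 2 :* s :+ (con 1 :+ n) :* s) refl n (S (suc n)) ⟩
  2 * S (suc n) + suc n * S (suc n)
    -- Trading `suc n * S (suc n)` for `2 * T (suc n)` moves the weight inside the sum, where it
    -- becomes `suc k`.
    ≡⟨ cong (2 * S (suc n) +_) (2*convolution-self catalan (suc n)) ⟨
  2 * S (suc n) + 2 * T (suc n)
    ≡⟨ solve 2 (λ s t → con 2 :* s :+ con 2 :* t := con 2 :* (s :+ t)) refl (S (suc n)) (T (suc n)) ⟩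
  2 * (S (suc n) + T (suc n))
    ≡⟨ cong (2 *_) (convolution-distribʳ-+ catalan (λ k → k * catalan k) catalan (suc n)) ⟨
  2 * convolution (λ k → suc k * catalan k) catalan (suc n)
    -- The term `k = 0` splits off by computation; in the others the weight is the one to which
    -- `catalan-suc` applies.
    ≡⟨⟩
  2 * (1 * catalan (suc n) + convolution (λ k → (2 + k) * catalan (suc k)) catalan n)
    ≡⟨ cong (λ x → 2 * (1 * catalan (suc n) + x)) shifted ⟩
  2 * (1 * catalan (suc n) + (2 * S n + 4 * T n))
    ≡⟨ solve 3 (λ c s t → con 2 :* (con 1 :* c :+ (con 2 :* s :+ con 4 :* t))
                        := con 2 :* c :+ (con 4 :* s :+ con 4 :* (con 2 :* t)))
         refl (catalan (suc n)) (S n) (T n) ⟩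
  2 * catalan (suc n) + (4 * S n + 4 * (2 * T n))
    ≡⟨ cong (λ x → 2 * catalan (suc n) + (4 * S n + 4 * x)) (2*convolution-self catalan n) ⟩
  2 * catalan (suc n) + (4 * S n + 4 * (n * S n))
    -- The induction hypothesis enters once `T n` has been eliminated in favor of `S n`.
    ≡⟨ cong (λ s → 2 * catalan (suc n) + (4 * s + 4 * (n * s))) (catalan-convolution n) ⟩
  2 * catalan (suc n) + (4 * catalan (suc n) + 4 * (n * catalan (suc n)))
    ≡⟨ solve 2 (λ n c → con 2 :* c :+ (con 4 :* c :+ con 4 :* (n :* c))
                      := (con 2 :+ con 4 :* (con 1 :+ n)) :* c) refl n (catalan (suc n)) ⟩
  (2 + 4 * suc n) * catalan (suc n)
    ≡⟨ catalan-suc (suc n) ⟨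
  (3 + n) * catalan (suc (suc n)) ∎)
  where
  S = convolution catalan catalan
  T = convolution (λ k → k * catalan k) catalan

  shifted : convolution (λ k → (2 + k) * catalan (suc k)) catalan n ≡ 2 * S n + 4 * T n
  shifted = begin
    convolution (λ k → (2 + k) * catalan (suc k)) catalan n
      ≡⟨ convolution-congˡ catalan (λ k → trans (catalan-suc k)
           (solve 2 (λ k c → (con 2 :+ con 4 :* k) :* c := con 2 :* c :+ con 4 :* (k :* c)) refl k (catalan k))) n ⟩
    convolution (λ k → 2 * catalan k + 4 * (k * catalan k)) catalan n
      ≡⟨ convolution-distribʳ-+ (λ k → 2 * catalan k) (λ k → 4 * (k * catalan k)) catalan n ⟩
    convolution (λ k → 2 * catalan k) catalan n + convolution (λ k → 4 * (k * catalan k)) catalan n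
      ≡⟨ cong₂ _+_ (convolution-*ˡ 2 catalan catalan n) (convolution-*ˡ 4 (λ k → k * catalan k) catalan n) ⟩
    2 * S n + 4 * T n ∎

-- Enumeration of forests and plane trees

-- A nonempty forest splits into the `k` vertices below its first root and the `n ∸ k` vertices of
-- the remaining trees, which is the Catalan recurrence. Any `d` above `n` is allowed because both
-- parts are enumerated with the same bound.
length-forests : ∀ d n → n ≤ d → length (forests d n) ≡ catalan n
length-forests d       zero    _         = refl
length-forests (suc d) (suc n) (s≤s n≤d) = begin
  length (forests (suc d) (suc n))
    ≡⟨ length-concatMap split (upTo (suc n)) ⟩
  sum (map (length ∘ split) (upTo (suc n)))
    ≡⟨ cong sum (map-cong-local (All.map (λ {k} k<1+n → trans
         (length-cartesianProductWith _ (forests d k) (forests d (n ∸ k)))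
         (cong₂ _*_ (length-forests d k (≤-trans (≤-pred k<1+n) n≤d))
                    (length-forests d (n ∸ k) (≤-trans (m∸n≤m n k) n≤d))))
         (All.all-upTo (suc n)))) ⟩
  sum (map (λ k → catalan k * catalan (n ∸ k)) (upTo (suc n)))
    ≡⟨ cong sum (map-upTo (λ k → catalan k * catalan (n ∸ k)) (suc n)) ⟩
  convolution catalan catalan n
    ≡⟨ catalan-convolution n ⟩
  catalan (suc n) ∎
  where
  split : ℕ → List (List PlaneTree)
  split k = cartesianProductWith (λ ts us → node ts ∷ us) (forests d k) (forests d (n ∸ k))

-- Removing the root leaves a forest with one vertex fewer, hence the index shift.
length-planeTrees : ∀ n → length (planeTrees (suc n)) ≡ catalan n
length-planeTrees n = trans (length-map node (forests n n)) (length-forests n n ≤-refl)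

-- Closed forms for the colored tree counts

module _ {m r : ℕ} (A : ColoringMatrix m) (rows : RowSumsEqual A r) where

  treeCountWithRoot-catalan : ∀ i n → n ≥ 1 → treeCountWithRoot A i n ≡ r ^ (n ∸ 1) * catalan (n ∸ 1)
  treeCountWithRoot-catalan i (suc n) _ = begin
    treeCountWithRoot A i (suc n)            ≡⟨ treeCountWithRoot≡ A rows i (suc n) ⟩
    length (planeTrees (suc n)) * r ^ n      ≡⟨ cong (_* r ^ n) (length-planeTrees n) ⟩
    catalan n * r ^ n                        ≡⟨ *-comm (catalan n) (r ^ n) ⟩
    r ^ n * catalan n                        ∎

  treeCount-catalan : ∀ n → n ≥ 1 → treeCount A n ≡ m * (r ^ (n ∸ 1) * catalan (n ∸ 1))
  treeCount-catalan (suc n) _ = begin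
    treeCount A (suc n)                      ≡⟨ treeCount≡ A rows (suc n) ⟩
    length (planeTrees (suc n)) * (m * r ^ n) ≡⟨ cong (_* (m * r ^ n)) (length-planeTrees n) ⟩
    catalan n * (m * r ^ n)                  ≡⟨ solve 3 (λ c m x → c :* (m :* x) := m :* (x :* c)) refl (catalan n) m (r ^ n) ⟩
    m * (r ^ n * catalan n)                  ∎

theorem20 : (m r : ℕ) →
    ((A : ColoringMatrix m) → RowSumsEqual A r →
    ((i : Fin m) (n : ℕ) → n ≥ 1 → treeCountWithRoot A i n ≡ r ^ (n ∸ 1) * catalan (n ∸ 1))
    × ((n : ℕ) → n ≥ 1 → treeCount A n ≡ m * (r ^ (n ∸ 1) * catalan (n ∸ 1)))
    × ((i j : Fin m) → Interchangeable A i j))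
    × ((A B : ColoringMatrix m) → RowSumsEqual A r → RowSumsEqual B r →
    StrictlyTreeColoringEquivalent A B)
theorem20 m r =
  (λ A rows →
    treeCountWithRoot-catalan A rows ,
    treeCount-catalan A rows ,
    λ i j n n≥1 → trans (treeCountWithRoot-catalan A rows i n n≥1) (sym (treeCountWithRoot-catalan A rows j n n≥1))) ,
  λ A B rowsA rowsB n n≥1 i →
    trans (treeCountWithRoot-catalan A rowsA i n n≥1) (sym (treeCountWithRoot-catalan B rowsB i n n≥1))
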